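{- For any prime power $q\geq 3$, the Petersen graph is a subgraph of the Erd\H{o}s-R\'enyi graph $ER_q$.
   Context: The Erd\H{o}s-R\'enyi graph $ER_q$ is the graph whose vertices are the points of the projective plane $PG(2,q)$ (the $1$-dimensional subspaces of $\mathbb{F}_q^3$), in which two distinct points $(x_0,x_1,x_2)$ and $(y_0,y_1,y_2)$ are adjacent if and only if $x_0y_0+x_1y_1+x_2y_2=0$. "Subgraph" means not necessarily induced subgraph. -}

module Defs where

open import Level using (0ℓ)
open import Data.Nat using (ℕ; _≥_; _^_)
open import Data.Nat.Primality using (Prime)
open import Data.Fin using (Fin; _<_)
open import Data.Product using (Σ; Σ-syntax; ∃-syntax; _×_; _,_)
open import Relation.Binary.PropositionalEquality using (_≡_; _≢_)
open import Relation.Nullary using (¬_)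
open import Algebra.Structures using (IsCommutativeRing)
open import Function.Bundles using (_↔_)

IsPrimePower : ℕ → Set
IsPrimePower q = ∃[ p ] ∃[ k ] (Prime p × k ≥ 1 × q ≡ p ^ k)

record Field : Set₁ where
  infixl 7 _*_
  infixl 6 _+_
  field
    Carrier : Set
    _+_ _*_ : Carrier → Carrier → Carrier
    -_      : Carrier → Carrier
    0# 1#   : Carrier
    isCommutativeRing : IsCommutativeRing _≡_ _+_ _*_ -_ 0# 1#
    0≢1     : 0# ≢ 1#
    inverse : ∀ x → x ≢ 0# → ∃[ y ] (x * y ≡ 1#)

HasOrder : Field → ℕ → Set
HasOrder F q = Field.Carrier F ↔ Fin q

module ProjectivePlane (F : Field) where
  open Field F

  Vec3 : Set
  Vec3 = Carrier × Carrier × Carrier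

  zero3 : Vec3
  zero3 = 0# , 0# , 0#

  dot : Vec3 → Vec3 → Carrier
  dot (x0 , x1 , x2) (y0 , y1 , y2) = x0 * y0 + x1 * y1 + x2 * y2

  scale : Carrier → Vec3 → Vec3
  scale c (x0 , x1 , x2) = c * x0 , c * x1 , c * x2

  -- A nonzero vector of F^3, representing the point (1-dim subspace) it spans.
  NonzeroVec : Set
  NonzeroVec = Σ[ v ∈ Vec3 ] v ≢ zero3

  SamePoint : NonzeroVec → NonzeroVec → Set
  SamePoint (v , _) (w , _) = ∃[ c ] (c ≢ 0# × v ≡ scale c w)

  -- adjacency in ER_q between two points given by representatives
  -- (distinct points, orthogonal representatives; well-defined under rescaling)
  ERAdj : NonzeroVec → NonzeroVec → Set
  ERAdj u v = ¬ SamePoint u v × dot (Σ.proj₁ u) (Σ.proj₁ v) ≡ 0#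

-- The Petersen graph as the Kneser graph K(5,2): vertices are 2-subsets {i,j}
-- (i < j) of {0,…,4}, adjacent iff disjoint.
PetersenVertex : Set
PetersenVertex = Σ[ p ∈ Fin 5 × Fin 5 ] (Σ.proj₁ p < Σ.proj₂ p)

PetersenAdj : PetersenVertex → PetersenVertex → Set
PetersenAdj ((i , j) , _) ((k , l) , _) = i ≢ k × i ≢ l × j ≢ k × j ≢ l

PetersenSubgraphOfER : Field → Set
PetersenSubgraphOfER F =
  Σ[ φ ∈ (PetersenVertex → NonzeroVec) ]
    ((∀ u v → u ≢ v → ¬ SamePoint (φ u) (φ v)) ×
     (∀ u v → PetersenAdj u v → ERAdj (φ u) (φ v)))
  where open ProjectivePlane F

{-# OPTIONS --safe #-}

-- In odd characteristic the ten vertices are placed on vectors with coordinates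
-- in {0, 1, -1}, which stay pairwise non-proportional because 0, 1 and -1 are
-- distinct.  In characteristic 2 they are placed on vectors with coordinates in
-- {0, 1, t, 1 + t}, where t is a field element other than 0 and 1 (it exists
-- because q ≥ 3).  There the orthogonality relations are identities in F₂[t],
-- and every two of the vectors have a 2×2 minor which is nonzero of degree at
-- most 2 in t and different from 1 + t + t², hence a product of factors t and
-- 1 + t.
-- Both configurations were found from Chasles' theorem: a triangle A, B, C, its
-- polar triangle A′ = B × C, B′ = C × A, C′ = A × B, the points P = A × A′,
-- Q = B × B′, R = C × C′, and the pole O of the line carrying P, Q and R.
module Submission where

open import Defs
open import Data.Nat using (ℕ; _≥_)
open import Data.Nat.Base using (z≤n; s≤s) renaming (_+_ to _+ᴺ_)
open import Data.Bool using (Bool; true; false; _∧_; _xor_)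
open import Data.Bool.Properties using () renaming (_≟_ to _≟ᵇ_)
open import Data.Empty using (⊥-elim)
open import Data.Fin using (Fin; zero; suc; _<_)
open import Data.Fin.Patterns using (0F; 1F; 2F; 3F; 4F)
open import Data.Fin.Properties using (_≟_; _<?_; <-irrelevant; all?)
open import Data.Product using (∃-syntax; _×_; _,_; proj₁; proj₂)
open import Data.Product.Properties using (≡-dec)
open import Data.Sum using (_⊎_; inj₁; inj₂)
open import Function using (_∘_)
open import Function.Bundles using (Inverse)
open import Function.Properties.Inverse using (↔⇒↣)
open import Algebra.Bundles using (CommutativeRing)
open import Level using (0ℓ)
open import Relation.Binary.Definitions using (DecidableEquality)
open import Relation.Binary.PropositionalEquality
open import Relation.Nullary using (¬_; Dec; yes; no)
open import Relation.Nullary.Decidable using (via-injection; _×-dec_; _⊎-dec_; _→-dec_; ¬?; from-yes)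
import Algebra.Properties.Ring as RingProperties
import Algebra.Solver.Ring.NaturalCoefficients.Default as SemiringSolver

-- Combinatorics of vertices and indices.

other-vertex : (u : PetersenVertex) → ∃[ v ] u ≢ v
other-vertex ((0F , 1F) , _) = ((0F , 2F) , s≤s z≤n) , λ ()
other-vertex ((0F , 2F) , _) = ((0F , 1F) , s≤s z≤n) , λ ()
other-vertex ((0F , suc (suc (suc _))) , _) = ((0F , 1F) , s≤s z≤n) , λ ()
other-vertex ((suc _ , _) , _) = ((0F , 1F) , s≤s z≤n) , λ ()

vertex-≡ : ∀ {u v : PetersenVertex} → proj₁ u ≡ proj₁ v → u ≡ v
vertex-≡ {p , i<j} {.p , i<j′} refl = cong (p ,_) (<-irrelevant i<j i<j′)

-- Through the bijection of a field with `Fin q`, this supplies an element other than 0 and 1.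
third-element : ∀ {n} (a b : Fin (3 +ᴺ n)) → ∃[ c ] c ≢ a × c ≢ b
third-element zero          zero          = 1F , (λ ()) , λ ()
third-element zero          (suc zero)    = 2F , (λ ()) , λ ()
third-element zero          (suc (suc _)) = 1F , (λ ()) , λ ()
third-element (suc zero)    zero          = 2F , (λ ()) , λ ()
third-element (suc (suc _)) zero          = 1F , (λ ()) , λ ()
third-element (suc _)       (suc _)       = 0F , (λ ()) , λ ()

-- Symbolic coordinates and their decision procedures.

-- The orthogonality and independence of ten vectors are decided by evaluation
-- on symbolic coordinates, once for all fields.
record Coordinates : Set₁ where
  infixl 7 _⊗_
  infix 4 _#_ _#?_
  field
    -- Products form a type of their own, since linear polynomials multiply to quadratic ones.
    Entry Product : Set
    _⊗_      : Entry → Entry → Product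
    ZeroSum  : Product → Product → Product → Set
    zeroSum? : ∀ x y z → Dec (ZeroSum x y z)
    _#_      : Product → Product → Set
    _#?_     : ∀ x y → Dec (x # y)

  Vector Table : Set
  Vector = Entry × Entry × Entry
  Table = Fin 5 → Fin 5 → Vector

  -- Independence asks for a nonvanishing 2×2 minor, written as two different products so that no
  -- subtraction of symbols is needed.
  Orthogonal Independent : Vector → Vector → Set
  Orthogonal (x₀ , x₁ , x₂) (y₀ , y₁ , y₂) =
    ZeroSum (x₀ ⊗ y₀) (x₁ ⊗ y₁) (x₂ ⊗ y₂)
  Independent (x₀ , x₁ , x₂) (y₀ , y₁ , y₂) =
    x₀ ⊗ y₁ # x₁ ⊗ y₀ ⊎ x₀ ⊗ y₂ # x₂ ⊗ y₀ ⊎ x₁ ⊗ y₂ # x₂ ⊗ y₁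

  orthogonal? : ∀ x y → Dec (Orthogonal x y)
  orthogonal? _ _ = zeroSum? _ _ _

  independent? : ∀ x y → Dec (Independent x y)
  independent? _ _ = (_ #? _) ⊎-dec (_ #? _) ⊎-dec (_ #? _)

  -- The four indices range over `Fin 5` separately, with the order proofs as hypotheses, so that
  -- `all?` decides the whole statement.
  IsPetersen : Table → Set
  IsPetersen τ = ∀ i j k l → i < j → k < l →
    (i ≢ k × i ≢ l × j ≢ k × j ≢ l → Orthogonal (τ i j) (τ k l)) ×
    ((i , j) ≢ (k , l) → Independent (τ i j) (τ k l))

  isPetersen? : ∀ τ → Dec (IsPetersen τ)
  isPetersen? τ = all? λ i → all? λ j → all? λ k → all? λ l →
    (i <? j) →-dec ((k <? l) →-dec
      ((((¬? (i ≟ k)) ×-dec (¬? (i ≟ l)) ×-dec (¬? (j ≟ k)) ×-dec (¬? (j ≟ l)))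
          →-dec orthogonal? (τ i j) (τ k l)) ×-dec
       (¬? (≡-dec _≟_ _≟_ (i , j) (k , l)) →-dec independent? (τ i j) (τ k l))))

-- Signs and the configuration in odd characteristic.

data Trit : Set where
  𝟎 𝟏 -𝟏 : Trit

neg : Trit → Trit
neg 𝟎 = 𝟎
neg 𝟏 = -𝟏
neg -𝟏 = 𝟏

_·_ : Trit → Trit → Trit
𝟎 · _ = 𝟎
𝟏 · y = y
-𝟏 · y = neg y

_≟ᵗ_ : DecidableEquality Trit
𝟎 ≟ᵗ 𝟎 = yes refl
𝟎 ≟ᵗ 𝟏 = no λ ()
𝟎 ≟ᵗ -𝟏 = no λ ()
𝟏 ≟ᵗ 𝟎 = no λ ()
𝟏 ≟ᵗ 𝟏 = yes refl
𝟏 ≟ᵗ -𝟏 = no λ ()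
-𝟏 ≟ᵗ 𝟎 = no λ ()
-𝟏 ≟ᵗ 𝟏 = no λ ()
-𝟏 ≟ᵗ -𝟏 = yes refl

trits : Coordinates
trits = record
  { _⊗_      = _·_
  -- Three signs have integer sum 0 exactly when one is 0 and the others are opposite. `1 + 1 + 1`
  -- is left out, as it vanishes only in characteristic 3.
  ; ZeroSum  = λ x y z → (x ≡ 𝟎 × y ≡ neg z) ⊎ (y ≡ 𝟎 × x ≡ neg z) ⊎ (z ≡ 𝟎 × x ≡ neg y)
  ; zeroSum? = λ x y z → ((x ≟ᵗ 𝟎) ×-dec (y ≟ᵗ neg z)) ⊎-dec
                         ((y ≟ᵗ 𝟎) ×-dec (x ≟ᵗ neg z)) ⊎-dec
                         ((z ≟ᵗ 𝟎) ×-dec (x ≟ᵗ neg y))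
  ; _#_      = _≢_
  ; _#?_     = λ x y → ¬? (x ≟ᵗ y)
  }

-- In both tables the pairs i < j, in lexicographic order, carry O, C, B, A, C′, B′,
-- A′, P, Q, R; the entries with i ≥ j are junk.
tritTable : Coordinates.Table trits
tritTable 0F 1F = 𝟏 , -𝟏 , 𝟎
tritTable 0F 2F = 𝟏 , -𝟏 , -𝟏
tritTable 0F 3F = 𝟏 , 𝟎 , -𝟏
tritTable 0F 4F = 𝟎 , 𝟏 , 𝟏
tritTable 1F 2F = 𝟏 , -𝟏 , 𝟏
tritTable 1F 3F = 𝟎 , 𝟏 , -𝟏
tritTable 1F 4F = 𝟏 , 𝟎 , 𝟏
tritTable 2F 3F = 𝟏 , 𝟏 , -𝟏
tritTable 2F 4F = 𝟏 , 𝟏 , 𝟏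
tritTable 3F 4F = 𝟏 , 𝟏 , 𝟎
tritTable _  _  = 𝟎 , 𝟎 , 𝟎

tritTable-isPetersen : Coordinates.IsPetersen trits tritTable
tritTable-isPetersen = from-yes (Coordinates.isPetersen? trits tritTable)

-- Polynomials over F₂ and the configuration in characteristic 2.

-- Polynomials over F₂ as their coefficients, constant term first.
Linear Quadratic : Set
Linear = Bool × Bool
Quadratic = Bool × Bool × Bool

_≟²_ : DecidableEquality Quadratic
_≟²_ = ≡-dec _≟ᵇ_ (≡-dec _≟ᵇ_ _≟ᵇ_)

_⊙_ : Linear → Linear → Quadratic
(a , b) ⊙ (c , d) = a ∧ c , (a ∧ d) xor (b ∧ c) , b ∧ d

_⊕_ : Quadratic → Quadratic → Quadratic
(a , b , c) ⊕ (a′ , b′ , c′) = a xor a′ , b xor b′ , c xor c′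

-- Polynomials invertible in F₂[t, 1/t, 1/(1 + t)].
IsUnit : Quadratic → Set
IsUnit x = x ≢ (false , false , false) × x ≢ (true , true , true)

polynomials : Coordinates
polynomials = record
  { _⊗_      = _⊙_
  ; ZeroSum  = λ x y z → (x ⊕ y) ⊕ z ≡ (false , false , false)
  ; zeroSum? = λ x y z → ((x ⊕ y) ⊕ z) ≟² (false , false , false)
  -- Over F₂ the sum is the difference, so `x ⊕ y` is the minor itself.
  ; _#_      = λ x y → IsUnit (x ⊕ y)
  ; _#?_     = λ x y → ¬? ((x ⊕ y) ≟² (false , false , false)) ×-dec
                       ¬? ((x ⊕ y) ≟² (true , true , true))
  }

polynomialTable : Coordinates.Table polynomials
polynomialTable = table
  where
  pattern 𝟘 = false , false
  pattern 𝟙 = true , false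
  pattern t = false , true
  pattern s = true , true

  table : Coordinates.Table polynomials
  table 0F 1F = s , 𝟙 , t
  table 0F 2F = 𝟙 , 𝟙 , t
  table 0F 3F = 𝟘 , 𝟙 , 𝟙
  table 0F 4F = 𝟘 , 𝟘 , 𝟙
  table 1F 2F = 𝟙 , 𝟘 , 𝟘
  table 1F 3F = 𝟙 , 𝟙 , 𝟘
  table 1F 4F = s , 𝟙 , 𝟙
  table 2F 3F = 𝟙 , s , 𝟘
  table 2F 4F = 𝟙 , 𝟙 , 𝟙
  table 3F 4F = 𝟘 , t , 𝟙
  table _  _  = 𝟘 , 𝟘 , 𝟘

polynomialTable-isPetersen : Coordinates.IsPetersen polynomials polynomialTable
polynomialTable-isPetersen = from-yes (Coordinates.isPetersen? polynomials polynomialTable)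

-- Independence over a field and transfer from symbols.

module _ (F : Field) where
  open Field F
  open ProjectivePlane F

  private
    ring : CommutativeRing 0ℓ 0ℓ
    ring = record { isCommutativeRing = isCommutativeRing }

  open CommutativeRing ring using (+-identityˡ; +-identityʳ; -‿inverseˡ; -‿inverseʳ; *-assoc; *-comm; *-identityˡ; distribʳ; zeroˡ; zeroʳ)
  open RingProperties (CommutativeRing.ring ring) using (-0#≈0#; -‿involutive; -1*x≈-x; +-cancelˡ)

  *-nonzero : ∀ {x y} → x ≢ 0# → y ≢ 0# → x * y ≢ 0#
  *-nonzero {x} {y} x≢0 y≢0 xy≡0 with inverse x x≢0
  ... | x⁻¹ , xx⁻¹≡1 = y≢0 (begin
    y               ≡⟨ *-identityˡ y ⟨
    1# * y          ≡⟨ cong (_* y) xx⁻¹≡1 ⟨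
    x * x⁻¹ * y     ≡⟨ cong (_* y) (*-comm x x⁻¹) ⟩
    x⁻¹ * x * y     ≡⟨ *-assoc x⁻¹ x y ⟩
    x⁻¹ * (x * y)   ≡⟨ cong (x⁻¹ *_) xy≡0 ⟩
    x⁻¹ * 0#        ≡⟨ zeroʳ x⁻¹ ⟩
    0#              ∎)
    where open ≡-Reasoning

  LinIndependent : Vec3 → Vec3 → Set
  LinIndependent (x₀ , x₁ , x₂) (y₀ , y₁ , y₂) =
    x₀ * y₁ ≢ x₁ * y₀ ⊎ x₀ * y₂ ≢ x₂ * y₀ ⊎ x₁ * y₂ ≢ x₂ * y₁

  independent⇒nonzero : ∀ {v w} → LinIndependent v w → v ≢ zero3
  independent⇒nonzero indep refl = contra indep
    where
    0≡0 : ∀ {y z} → 0# * y ≡ 0# * z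
    0≡0 = trans (zeroˡ _) (sym (zeroˡ _))
    contra : ∀ {w} → ¬ LinIndependent zero3 w
    contra (inj₁ x)        = x 0≡0
    contra (inj₂ (inj₁ x)) = x 0≡0
    contra (inj₂ (inj₂ x)) = x 0≡0

  -- Every 2×2 minor of a vector and its multiple vanishes by commutativity.
  independent⇒¬samePoint : ∀ {v w} → LinIndependent (proj₁ v) (proj₁ w) → ¬ SamePoint v w
  independent⇒¬samePoint {w = w , _} indep (c , _ , refl) = contra w indep
    where
    minor : ∀ y z → c * y * z ≡ c * z * y
    minor y z = trans (*-assoc c y z) (trans (cong (c *_) (*-comm y z)) (sym (*-assoc c z y)))
    contra : ∀ w → ¬ LinIndependent (scale c w) w
    contra _ (inj₁ x)        = x (minor _ _)
    contra _ (inj₂ (inj₁ x)) = x (minor _ _)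
    contra _ (inj₂ (inj₂ x)) = x (minor _ _)

  petersenFromVectors : (φ : PetersenVertex → Vec3) →
    (∀ u v → PetersenAdj u v → dot (φ u) (φ v) ≡ 0#) →
    (∀ u v → u ≢ v → LinIndependent (φ u) (φ v)) →
    PetersenSubgraphOfER F
  petersenFromVectors φ orth indep = ψ , distinct , λ u v adj →
    -- Adjacent vertices differ: for equal ones `proj₁ adj` would refute a reflexive equality.
    distinct u v (λ { refl → proj₁ adj refl }) , orth u v adj
    where
    ψ : PetersenVertex → NonzeroVec
    -- A vector independent of some other vector is nonzero, so any second vertex serves.
    ψ u = φ u , independent⇒nonzero (indep u _ (proj₂ (other-vertex u)))
    distinct : ∀ u v → u ≢ v → ¬ SamePoint (ψ u) (ψ v)
    distinct u v u≢v = independent⇒¬samePoint {ψ u} {ψ v} (indep u v u≢v)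

  -- Soundness in one direction suffices: a symbolic `ZeroSum` or `#` must hold in the field, while
  -- its failure says nothing.
  record Interpretation (C : Coordinates) : Set where
    open Coordinates C
    field
      ⟦_⟧ₑ : Entry → Carrier
      ⟦_⟧  : Product → Carrier
      ⊗-homo : ∀ x y → ⟦ x ⊗ y ⟧ ≡ ⟦ x ⟧ₑ * ⟦ y ⟧ₑ
      zeroSum-sound : ∀ x y z → ZeroSum x y z → ⟦ x ⟧ + ⟦ y ⟧ + ⟦ z ⟧ ≡ 0#
      #-sound : ∀ x y → x # y → ⟦ x ⟧ ≢ ⟦ y ⟧

    ⟦_⟧ᵥ : Vector → Vec3
    ⟦ x , y , z ⟧ᵥ = ⟦ x ⟧ₑ , ⟦ y ⟧ₑ , ⟦ z ⟧ₑ

    orthogonal-sound : ∀ v w → Orthogonal v w → dot ⟦ v ⟧ᵥ ⟦ w ⟧ᵥ ≡ 0#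
    orthogonal-sound (x₀ , x₁ , x₂) (y₀ , y₁ , y₂) orth = trans
      (cong₂ _+_ (cong₂ _+_ (sym (⊗-homo x₀ y₀)) (sym (⊗-homo x₁ y₁))) (sym (⊗-homo x₂ y₂)))
      (zeroSum-sound _ _ _ orth)

    minor-sound : ∀ x y z w → x ⊗ y # z ⊗ w → ⟦ x ⟧ₑ * ⟦ y ⟧ₑ ≢ ⟦ z ⟧ₑ * ⟦ w ⟧ₑ
    minor-sound x y z w xy#zw eq =
      #-sound _ _ xy#zw (trans (⊗-homo x y) (trans eq (sym (⊗-homo z w))))

    independent-sound : ∀ v w → Independent v w → LinIndependent ⟦ v ⟧ᵥ ⟦ w ⟧ᵥ
    independent-sound _ _ (inj₁ x)        = inj₁ (minor-sound _ _ _ _ x)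
    independent-sound _ _ (inj₂ (inj₁ x)) = inj₂ (inj₁ (minor-sound _ _ _ _ x))
    independent-sound _ _ (inj₂ (inj₂ x)) = inj₂ (inj₂ (minor-sound _ _ _ _ x))

    petersenFromTable : ∀ τ → IsPetersen τ → PetersenSubgraphOfER F
    petersenFromTable τ pet = petersenFromVectors (λ { ((i , j) , _) → ⟦ τ i j ⟧ᵥ })
      (λ { ((i , j) , i<j) ((k , l) , k<l) adj →
           orthogonal-sound (τ i j) (τ k l) (proj₁ (pet i j k l i<j k<l) adj) })
      (λ { ((i , j) , i<j) ((k , l) , k<l) u≢v →
           independent-sound (τ i j) (τ k l)
             (proj₂ (pet i j k l i<j k<l) (u≢v ∘ vertex-≡)) })

  -- Evaluation of signs in odd characteristic.

  module OddCharacteristic (1+1≢0 : 1# + 1# ≢ 0#) where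

    ⟦_⟧ᵗ : Trit → Carrier
    ⟦ 𝟎 ⟧ᵗ = 0#
    ⟦ 𝟏 ⟧ᵗ = 1#
    ⟦ -𝟏 ⟧ᵗ = - 1#

    neg-homo : ∀ x → ⟦ neg x ⟧ᵗ ≡ - ⟦ x ⟧ᵗ
    neg-homo 𝟎 = sym -0#≈0#
    neg-homo 𝟏 = refl
    neg-homo -𝟏 = sym (-‿involutive 1#)

    ·-homo : ∀ x y → ⟦ x · y ⟧ᵗ ≡ ⟦ x ⟧ᵗ * ⟦ y ⟧ᵗ
    ·-homo 𝟎 y = sym (zeroˡ _)
    ·-homo 𝟏 y = sym (*-identityˡ _)
    ·-homo -𝟏 y = trans (neg-homo y) (sym (-1*x≈-x _))

    neg-inverseˡ : ∀ x → ⟦ neg x ⟧ᵗ + ⟦ x ⟧ᵗ ≡ 0#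
    neg-inverseˡ x = trans (cong (_+ ⟦ x ⟧ᵗ) (neg-homo x)) (-‿inverseˡ _)

    -1≢0 : - 1# ≢ 0#
    -1≢0 -1≡0 = 0≢1 (begin
      0#         ≡⟨ -‿inverseʳ 1# ⟨
      1# + - 1#  ≡⟨ cong (1# +_) -1≡0 ⟩
      1# + 0#    ≡⟨ +-identityʳ 1# ⟩
      1#         ∎)
      where open ≡-Reasoning

    -- Odd characteristic enters here.
    1≢-1 : 1# ≢ - 1#
    1≢-1 1≡-1 = 1+1≢0 (trans (cong (1# +_) 1≡-1) (-‿inverseʳ 1#))

    ⟦⟧-injective : ∀ x y → ⟦ x ⟧ᵗ ≡ ⟦ y ⟧ᵗ → x ≡ y
    ⟦⟧-injective 𝟎 𝟎 _  = refl
    ⟦⟧-injective 𝟎 𝟏 eq = ⊥-elim (0≢1 eq)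
    ⟦⟧-injective 𝟎 -𝟏 eq = ⊥-elim (-1≢0 (sym eq))
    ⟦⟧-injective 𝟏 𝟎 eq = ⊥-elim (0≢1 (sym eq))
    ⟦⟧-injective 𝟏 𝟏 _  = refl
    ⟦⟧-injective 𝟏 -𝟏 eq = ⊥-elim (1≢-1 eq)
    ⟦⟧-injective -𝟏 𝟎 eq = ⊥-elim (-1≢0 eq)
    ⟦⟧-injective -𝟏 𝟏 eq = ⊥-elim (1≢-1 (sym eq))
    ⟦⟧-injective -𝟏 -𝟏 _  = refl

    interpretation : Interpretation trits
    interpretation = record
      { ⟦_⟧ₑ   = ⟦_⟧ᵗ
      ; ⟦_⟧    = ⟦_⟧ᵗ
      ; ⊗-homo = ·-homo
      ; zeroSum-sound = λ
          { _ _ z (inj₁ (refl , refl)) →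
              trans (cong (_+ ⟦ z ⟧ᵗ) (+-identityˡ _)) (neg-inverseˡ z)
          ; _ _ z (inj₂ (inj₁ (refl , refl))) →
              trans (cong (_+ ⟦ z ⟧ᵗ) (+-identityʳ _)) (neg-inverseˡ z)
          ; _ y _ (inj₂ (inj₂ (refl , refl))) →
              trans (+-identityʳ _) (neg-inverseˡ y) }
      ; #-sound = λ x y x≢y → x≢y ∘ ⟦⟧-injective x y
      }

  -- Evaluation of polynomials at t in characteristic 2.

  module EvenCharacteristic
    (1+1≡0 : 1# + 1# ≡ 0#) (t : Carrier) (t≢0 : t ≢ 0#) (t≢1 : t ≢ 1#) where

    open SemiringSolver (CommutativeRing.commutativeSemiring ring)
      using (solve; _:=_; _:+_; _:*_)

    ⟦_⟧ᵇ : Bool → Carrier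
    ⟦ false ⟧ᵇ = 0#
    ⟦ true  ⟧ᵇ = 1#

    xor-homo : ∀ a b → ⟦ a xor b ⟧ᵇ ≡ ⟦ a ⟧ᵇ + ⟦ b ⟧ᵇ
    xor-homo false b     = sym (+-identityˡ _)
    xor-homo true  false = sym (+-identityʳ _)
    xor-homo true  true  = sym 1+1≡0

    ∧-homo : ∀ a b → ⟦ a ∧ b ⟧ᵇ ≡ ⟦ a ⟧ᵇ * ⟦ b ⟧ᵇ
    ∧-homo false b = sym (zeroˡ _)
    ∧-homo true  b = sym (*-identityˡ _)

    ⟦_⟧¹ : Linear → Carrier
    ⟦ a , b ⟧¹ = ⟦ a ⟧ᵇ + ⟦ b ⟧ᵇ * t

    -- Coefficients are field elements rather than bits, so that after rewriting them only a
    -- semiring identity remains for the solver.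
    eval² : Carrier → Carrier → Carrier → Carrier
    eval² a b c = a + b * t + c * (t * t)

    eval²-cong : ∀ {a a′ b b′ c c′} → a ≡ a′ → b ≡ b′ → c ≡ c′ → eval² a b c ≡ eval² a′ b′ c′
    eval²-cong refl refl refl = refl

    ⟦_⟧² : Quadratic → Carrier
    ⟦ a , b , c ⟧² = eval² ⟦ a ⟧ᵇ ⟦ b ⟧ᵇ ⟦ c ⟧ᵇ

    ⊙-homo : ∀ x y → ⟦ x ⊙ y ⟧² ≡ ⟦ x ⟧¹ * ⟦ y ⟧¹
    ⊙-homo (a , b) (c , d) = trans
      (eval²-cong (∧-homo a c)
        (trans (xor-homo (a ∧ d) (b ∧ c)) (cong₂ _+_ (∧-homo a d) (∧-homo b c)))
        (∧-homo b d))
      (solve 5 (λ a b c d t →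
          a :* c :+ (a :* d :+ b :* c) :* t :+ b :* d :* (t :* t) :=
          (a :+ b :* t) :* (c :+ d :* t))
        refl ⟦ a ⟧ᵇ ⟦ b ⟧ᵇ ⟦ c ⟧ᵇ ⟦ d ⟧ᵇ t)

    ⊕-homo : ∀ x y → ⟦ x ⊕ y ⟧² ≡ ⟦ x ⟧² + ⟦ y ⟧²
    ⊕-homo (a , b , c) (a′ , b′ , c′) = trans
      (eval²-cong (xor-homo a a′) (xor-homo b b′) (xor-homo c c′))
      (solve 7 (λ a b c a′ b′ c′ t →
          a :+ a′ :+ (b :+ b′) :* t :+ (c :+ c′) :* (t :* t) :=
          (a :+ b :* t :+ c :* (t :* t)) :+ (a′ :+ b′ :* t :+ c′ :* (t :* t)))
        refl ⟦ a ⟧ᵇ ⟦ b ⟧ᵇ ⟦ c ⟧ᵇ ⟦ a′ ⟧ᵇ ⟦ b′ ⟧ᵇ ⟦ c′ ⟧ᵇ t)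

    zero-eval : ⟦ false , false , false ⟧² ≡ 0#
    zero-eval = trans (cong₂ _+_ (trans (+-identityˡ _) (zeroˡ t)) (zeroˡ _)) (+-identityˡ 0#)

    x+x≡0 : ∀ x → x + x ≡ 0#
    x+x≡0 x = begin
      x + x            ≡⟨ cong₂ _+_ (*-identityˡ x) (*-identityˡ x) ⟨
      1# * x + 1# * x  ≡⟨ distribʳ x 1# 1# ⟨
      (1# + 1#) * x    ≡⟨ cong (_* x) 1+1≡0 ⟩
      0# * x           ≡⟨ zeroˡ x ⟩
      0#               ∎
      where open ≡-Reasoning

    ⟦1⟧≢0 : ⟦ true , false ⟧¹ ≢ 0#
    ⟦1⟧≢0 eq = 0≢1 (sym (trans (sym (trans (cong (1# +_) (zeroˡ t)) (+-identityʳ 1#))) eq))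

    ⟦t⟧≢0 : ⟦ false , true ⟧¹ ≢ 0#
    ⟦t⟧≢0 eq = t≢0 (trans (sym (trans (+-identityˡ _) (*-identityˡ t))) eq)

    ⟦1+t⟧≢0 : ⟦ true , true ⟧¹ ≢ 0#
    -- From 1 + t = 0 = 1 + 1, cancelling 1 gives t = 1.
    ⟦1+t⟧≢0 eq = t≢1 (+-cancelˡ 1# t 1#
      (trans (cong (1# +_) (sym (*-identityˡ t))) (trans eq (sym 1+1≡0))))

    ⊙-nonzero : ∀ x y → ⟦ x ⟧¹ ≢ 0# → ⟦ y ⟧¹ ≢ 0# → ⟦ x ⊙ y ⟧² ≢ 0#
    ⊙-nonzero x y x≢0 y≢0 eq = *-nonzero x≢0 y≢0 (trans (sym (⊙-homo x y)) eq)

    -- Each remaining polynomial is a product of two factors among 1, t and 1 + t, for example 1 +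
    -- t² = (1 + t)². The excluded 1 + t + t² does vanish when t lies in F₄ outside F₂.
    unit-nonzero : ∀ x → IsUnit x → ⟦ x ⟧² ≢ 0#
    unit-nonzero (false , false , false) (x≢0 , _) = ⊥-elim (x≢0 refl)
    unit-nonzero (true  , false , false) _ = ⊙-nonzero (true , false) (true , false) ⟦1⟧≢0 ⟦1⟧≢0
    unit-nonzero (false , true  , false) _ = ⊙-nonzero (true , false) (false , true) ⟦1⟧≢0 ⟦t⟧≢0
    unit-nonzero (true  , true  , false) _ = ⊙-nonzero (true , false) (true , true) ⟦1⟧≢0 ⟦1+t⟧≢0
    unit-nonzero (false , false , true)  _ = ⊙-nonzero (false , true) (false , true) ⟦t⟧≢0 ⟦t⟧≢0
    unit-nonzero (true  , false , true)  _ = ⊙-nonzero (true , true) (true , true) ⟦1+t⟧≢0 ⟦1+t⟧≢0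
    unit-nonzero (false , true  , true)  _ = ⊙-nonzero (false , true) (true , true) ⟦t⟧≢0 ⟦1+t⟧≢0
    unit-nonzero (true  , true  , true)  (_ , x≢1+t+t²) = ⊥-elim (x≢1+t+t² refl)

    interpretation : Interpretation polynomials
    interpretation = record
      { ⟦_⟧ₑ   = ⟦_⟧¹
      ; ⟦_⟧    = ⟦_⟧²
      ; ⊗-homo = ⊙-homo
      ; zeroSum-sound = λ x y z eq →
          trans (cong (_+ ⟦ z ⟧²) (sym (⊕-homo x y)))
            (trans (sym (⊕-homo (x ⊕ y) z)) (trans (cong ⟦_⟧² eq) zero-eval))
      ; #-sound = λ x y x#y eq → unit-nonzero (x ⊕ y) x#y
          -- Equal values of `x` and `y` would make the value of `x ⊕ y` a double, hence 0.
          (trans (⊕-homo x y) (trans (cong (_+ ⟦ y ⟧²) eq) (x+x≡0 _)))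
      }

theorem1p3 : (q : ℕ) → IsPrimePower q → q ≥ 3 → (F : Field) → HasOrder F q → PetersenSubgraphOfER F
theorem1p3 q _ (s≤s (s≤s (s≤s _))) F order
  -- Equality in the field is decidable by comparison in `Fin q`, which allows the case split on the
  -- characteristic.
  with via-injection (↔⇒↣ order) _≟_ (1# + 1#) 0#
  where open Field F
... | no 1+1≢0 = Interpretation.petersenFromTable
  (OddCharacteristic.interpretation F 1+1≢0) tritTable tritTable-isPetersen
... | yes 1+1≡0 = Interpretation.petersenFromTable
  (EvenCharacteristic.interpretation F 1+1≡0 t
    (avoid (proj₁ (proj₂ third))) (avoid (proj₂ (proj₂ third))))
  polynomialTable polynomialTable-isPetersen
  where
  open Field F using (Carrier; 0#; 1#)
  open Inverse order using (to; from; strictlyInverseˡ)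
  -- Matching on `q ≥ 3` has exposed `q` as 3 + n.
  third = third-element (to 0#) (to 1#)
  t : Carrier
  t = from (proj₁ third)
  avoid : ∀ {x} → proj₁ third ≢ to x → t ≢ x
  avoid c≢x refl = c≢x (sym (strictlyInverseˡ _))
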